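{- No rational in $(0,1)$ is realizable for any graph $H$. Moreover, $0$ is realizable for every graph $H$ without isolated vertices, and $1$ is realizable for every connected graph $H$.
   Context: Graphs are finite and simple; $v(H)$ denotes the number of vertices of $H$. A graph is $\mathcal{F}$-free, for a family of graphs $\mathcal{F}$, if it contains no (not necessarily induced) subgraph isomorphic to a member of $\mathcal{F}$. $\mathrm{ex}(n,H,\mathcal{F})$ is the maximum number of copies of $H$ (subgraphs isomorphic to $H$) that an $n$-vertex $\mathcal{F}$-free graph can have, with the convention that it is $0$ if there is no $\mathcal{F}$-free graph on $n$ vertices. A rational number $r\in[0,v(H)]$ is realizable for $H$ if there exists a finite family of graphs $\mathcal{F}$ such that $\mathrm{ex}(n,H,\mathcal{F})=\Theta(n^r)$ as $n\to\infty$. -}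

module Defs where

open import Data.Fin using (Fin)
open import Data.Fin.Properties using (any?; all?) renaming (_≟_ to _≟ᶠ_)
open import Data.Fin.Subset using (Subset; inside; outside; _∈_)
open import Data.Fin.Subset.Properties using (_∈?_; anySubset?)
open import Data.Integer as ℤ using (+_)
open import Data.List using (List; []; _∷_; cartesianProduct; cartesianProductWith; filter; length; map; mapMaybe)
open import Data.List.Extrema.Nat using (max)
open import Data.List.Relation.Unary.All as All using (All)
import Data.Maybe as Maybe
open import Data.Nat using (ℕ; zero; suc; _*_; _^_; _≤_)
open import Data.Product using (∃; _×_; _,_; proj₁; proj₂)
open import Data.Rational as ℚ using (ℚ; 0ℚ)
open import Data.Vec using (Vec; []; _∷_; lookup; tabulate)
open import Data.Vec.Properties using (lookup∘tabulate)
open import Function using (_∘_)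
open import Function.Bundles using (_⇔_; mk⇔; Equivalence)
open import Function.Definitions using (Injective)
open import Relation.Binary.Construct.Closure.ReflexiveTransitive using (Star)
open import Relation.Binary.Definitions using (Symmetric; Irreflexive)
open import Relation.Binary.PropositionalEquality using (_≡_; refl; sym; trans; subst₂; _≗_)
open import Relation.Nullary using (Dec; ¬_; ¬?; _×-dec_; _→-dec_; map′; dec⇒maybe)
open import Relation.Unary using (Pred; Decidable)
open import Level using (0ℓ)

private
  variable
    h n : ℕ

-- A binary relation on Fin n, given by the neighbourhood of each element.
-- First-order data is used so that equality of edge sets is _≡_ and the edge
-- sets on a given vertex set can be listed.
Edges : ℕ → Set
Edges n = Vec (Subset n) n

_∋_~_ : Edges n → Fin n → Fin n → Set
E ∋ x ~ y = y ∈ lookup E x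

record IsSimple (E : Edges n) : Set where
  field
    symmetric   : Symmetric (E ∋_~_)
    irreflexive : Irreflexive _≡_ (E ∋_~_)

record Graph (n : ℕ) : Set where
  constructor graph
  field
    edges    : Edges n
    isSimple : IsSimple edges

  _~_ : Fin n → Fin n → Set
  x ~ y = edges ∋ x ~ y

open Graph using (edges; _~_)

-- A pair (V(S), E(S)); it is a subgraph of G when S ⊑ G.
Part : ℕ → Set
Part n = Subset n × Edges n

record _⊑_ (S : Part n) (G : Graph n) : Set where
  field
    symmetric : Symmetric (proj₂ S ∋_~_)
    endpoints : ∀ x y → proj₂ S ∋ x ~ y → x ∈ proj₁ S × y ∈ proj₁ S
    contained : ∀ x y → proj₂ S ∋ x ~ y → _~_ G x y

-- φ is a graph isomorphism from H onto the graph S.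
record IsIso (H : Graph h) (S : Part n) (φ : Fin h → Fin n) : Set where
  field
    injective : Injective _≡_ _≡_ φ
    image     : ∀ x → x ∈ proj₁ S ⇔ ∃ λ i → φ i ≡ x
    adjacency : ∀ i j → _~_ H i j ⇔ (proj₂ S ∋ φ i ~ φ j)

_≅_ : Graph h → Part n → Set
H ≅ S = ∃ (IsIso H S)

IsCopy : Graph h → Graph n → Part n → Set
IsCopy H G S = S ⊑ G × H ≅ S

Contains : Graph n → Graph h → Set
Contains G H = ∃ (IsCopy H G)

Family : Set
Family = List (∃ Graph)

Free : Family → Graph n → Set
Free 𝓕 G = All (λ F → ¬ Contains G (proj₂ F)) 𝓕

NoIsolatedVertex : Graph h → Set
NoIsolatedVertex H = ∀ i → ∃ λ j → _~_ H i j

-- The graph with no vertices is not connected.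
Connected : Graph h → Set
Connected {h} H = Fin h × (∀ i j → Star (_~_ H) i j)

_⇔-dec_ : ∀ {A B : Set} → Dec A → Dec B → Dec (A ⇔ B)
A? ⇔-dec B? = map′ (λ (f , g) → mk⇔ f g)
                   (λ e → Equivalence.to e , Equivalence.from e)
                   ((A? →-dec B?) ×-dec (B? →-dec A?))

anyVec? : ∀ {A : Set} → (∀ {P : Pred A 0ℓ} → Decidable P → Dec (∃ P)) →
          ∀ {n} {P : Pred (Vec A n) 0ℓ} → Decidable P → Dec (∃ P)
anyVec? any {zero}  P? = map′ ([] ,_) (λ { ([] , p) → p }) (P? [])
anyVec? any {suc n} P? =
  map′ (λ (x , xs , p) → x ∷ xs , p) (λ { (x ∷ xs , p) → x , xs , p })
       (any (λ x → anyVec? any (λ xs → P? (x ∷ xs))))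

symmetric? : (E : Edges n) → Dec (Symmetric (E ∋_~_))
symmetric? E =
  map′ (λ s {x} {y} → s x y) (λ s x y → s {x} {y})
       (all? λ x → all? λ y → (y ∈? lookup E x) →-dec (x ∈? lookup E y))

simple? : Decidable (IsSimple {n})
simple? E =
  map′ {A = Symmetric (E ∋_~_) × (∀ x → ¬ (E ∋ x ~ x))}
       (λ (s , i) → record { symmetric = s ; irreflexive = λ { {x} refl → i x } })
       (λ s → IsSimple.symmetric s , λ x → IsSimple.irreflexive s refl)
       (symmetric? E ×-dec all? (λ x → ¬? (x ∈? lookup E x)))

subgraph? : (G : Graph n) → Decidable (_⊑ G)
subgraph? G (V , E) =
  map′ (λ (s , e , c) → record { symmetric = s ; endpoints = e ; contained = c })
       (λ s → let open _⊑_ s in (λ {x} {y} → symmetric {x} {y}) , endpoints , contained)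
       (symmetric? E
         ×-dec (all? λ x → all? λ y →
           (y ∈? lookup E x) →-dec ((x ∈? V) ×-dec (y ∈? V)))
         ×-dec (all? λ x → all? λ y →
           (y ∈? lookup E x) →-dec (y ∈? lookup (edges G) x)))

isIso? : (H : Graph h) (S : Part n) → Decidable (IsIso H S)
isIso? H (V , E) φ =
  map′ (λ (i , m , a) → record { injective = λ {x} {y} → i x y ; image = m ; adjacency = a })
       (λ s → let open IsIso s in (λ x y → injective {x} {y}) , image , adjacency)
       ((all? λ i → all? λ j → (φ i ≟ᶠ φ j) →-dec (i ≟ᶠ j))
         ×-dec (all? λ x → (x ∈? V) ⇔-dec any? (λ i → φ i ≟ᶠ x))
         ×-dec (all? λ i → all? λ j →
           (j ∈? lookup (edges H) i) ⇔-dec (φ j ∈? lookup E (φ i))))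

isIso-resp : (H : Graph h) (S : Part n) {φ ψ : Fin h → Fin n} →
             φ ≗ ψ → IsIso H S φ → IsIso H S ψ
isIso-resp H S eq s = record
  { injective = λ {x} {y} e → injective (trans (eq x) (trans e (sym (eq y))))
  ; image     = λ x → mk⇔
      (λ x∈ → let (i , e) = Equivalence.to (image x) x∈ in i , trans (sym (eq i)) e)
      (λ (i , e) → Equivalence.from (image x) (i , trans (eq i) e))
  ; adjacency = λ i j → mk⇔
      (subst₂ (proj₂ S ∋_~_) (eq i) (eq j) ∘ Equivalence.to (adjacency i j))
      (Equivalence.from (adjacency i j) ∘ subst₂ (proj₂ S ∋_~_) (sym (eq i)) (sym (eq j)))
  }
  where open IsIso s

iso? : (H : Graph h) → Decidable (λ (S : Part n) → H ≅ S)
iso? H S =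
  map′ (λ (v , p) → lookup v , p)
       (λ (φ , p) → tabulate φ , isIso-resp H S (λ i → sym (lookup∘tabulate φ i)) p)
       (anyVec? any? (λ v → isIso? H S (lookup v)))

isCopy? : (H : Graph h) (G : Graph n) → Decidable (IsCopy H G)
isCopy? H G S = subgraph? G S ×-dec iso? H S

contains? : (G : Graph n) (H : Graph h) → Dec (Contains G H)
contains? G H =
  map′ (λ (V , E , p) → (V , E) , p) (λ ((V , E) , p) → V , E , p)
       (anySubset? λ V → anyVec? anySubset? λ E → isCopy? H G (V , E))

free? : (𝓕 : Family) → Decidable (Free {n} 𝓕)
free? 𝓕 G = All.all? (λ F → ¬? (contains? G (proj₂ F))) 𝓕

-- All vectors with entries in the given list.
vectors : ∀ {A : Set} → List A → ∀ n → List (Vec A n)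
vectors xs zero    = [] ∷ []
vectors xs (suc n) = cartesianProductWith _∷_ xs (vectors xs n)

subsets : ∀ n → List (Subset n)
subsets n = vectors (outside ∷ inside ∷ []) n

parts : ∀ n → List (Part n)
parts n = cartesianProduct (subsets n) (vectors (subsets n) n)

graphs : ∀ n → List (Graph n)
graphs n = mapMaybe (λ E → Maybe.map (graph E) (dec⇒maybe (simple? E)))
                    (vectors (subsets n) n)

copies : Graph h → Graph n → ℕ
copies {n = n} H G = length (filter (isCopy? H G) (parts n))

-- The first argument of max is the value taken when no graph is 𝓕-free.
ex : ℕ → Graph h → Family → ℕ
ex n H 𝓕 = max 0 (map (copies H) (filter (free? 𝓕) (graphs n)))

-- e(n) = Θ(n^r) for r = p / q ≥ 0, where p = ∣ ↥ r ∣ and q = ↧ₙ r: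
-- for large n, e(n) ≤ B n^(p/q) and n^(p/q) ≤ A e(n). Both inequalities are
-- between nonnegative numbers and are raised to the power q to stay within ℕ.
-- Natural constants suffice, as A and B may be rounded up.
IsΘ-power : (ℕ → ℕ) → ℚ → Set
IsΘ-power e r = ∃ λ A → ∃ λ B → ∃ λ N → ∀ n → N ≤ n →
    (e n ^ q ≤ B ^ q * n ^ p) × (n ^ p ≤ (A * e n) ^ q)
  where
  p q : ℕ
  p = ℤ.∣ ℚ.↥ r ∣
  q = ℚ.↧ₙ r

Realizable : Graph h → ℚ → Set
Realizable {h} H r =
  (0ℚ ℚ.≤ r × r ℚ.≤ + h ℚ./ 1) ×
  ∃ λ (𝓕 : Family) → IsΘ-power (λ n → ex n H 𝓕) r

{-# OPTIONS --safe #-}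

-- Copies of H in G are the images of the embeddings of H into G.
--
-- Exponents in (0,1): if ex(n,H,𝓕) is unbounded, then for every t some 𝓕-free
-- graph has t copies of H. They lie on at most (h+1)t vertices, and the subgraph
-- induced on these is again 𝓕-free, so ex((h+1)t,H,𝓕) ≥ t for every t.
--
-- Exponent 0: forbid all graphs on 2(h+1) vertices with more than h non-isolated
-- vertices; a large graph is then free iff it has at most h non-isolated vertices.
--
-- Exponent 1: forbid the star with h leaves. Disjoint copies of H give the lower
-- bound; in a graph of bounded degree, a copy of a connected graph H lies in a
-- ball of bounded size around the image of a root of H, which gives the upper one.

module Submission where

open import Defs
open import Data.Fin using (Fin; zero; suc; inject≤; combine; remQuot)
open import Data.Fin.Properties using (any?; all?; injective⇒≤; inject≤-injective; remQuot-combine; combine-injective) renaming (_≟_ to _≟ᶠ_)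
open import Data.Fin.Subset using (Subset; inside; outside; _∈_)
open import Data.Fin.Subset.Properties using (_∈?_; ⊆-antisym)
open import Data.Integer as ℤ using (+_; +<+; -[1+_])
import Data.Integer.Properties as ℤ
open import Data.List using (List; []; _∷_; length; filter; map; concatMap; allFin; lookup; cartesianProductWith)
open import Data.List.Extrema.Nat using (max; max≤v⁺; v≤max⁺; xs≤max; argmax-sel)
open import Data.List.Membership.Propositional using (find; lose) renaming (_∈_ to _∈ˡ_)
open import Data.List.Membership.Propositional.Properties using (∈-lookup; ∈-filter⁺; ∈-filter⁻; ∈-map⁺; ∈-map⁻; ∈-allFin; ∈-concatMap⁺; ∈-cartesianProduct⁺; ∈-cartesianProductWith⁺)
open import Data.List.Properties using (length-map; length-++; length-tabulate)
open import Data.List.Relation.Unary.All as All using (All; []; _∷_)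
import Data.List.Relation.Unary.All.Properties as All
open import Data.List.Relation.Unary.AllPairs using ([]; _∷_)
open import Data.List.Relation.Unary.Any as Any using (here; there; index)
import Data.List.Relation.Unary.Any.Properties as Any
open import Data.List.Relation.Unary.Unique.Propositional using (Unique)
import Data.List.Relation.Unary.Unique.Propositional.Properties as Unique
open import Data.Maybe as Maybe using (Maybe)
open import Data.Maybe.Relation.Unary.Any using () renaming (Any to MAny; just to mjust)
open import Data.Nat as ℕ using (ℕ; zero; suc; _+_; _*_; _^_; _≤_; z≤n; s≤s; _<?_; >-nonZero)
open import Data.Nat.DivMod using (_/_; _%_; m≡m%n+[m/n]*n; m%n<n; m/n*n≤m; m≥n⇒m/n>0)
open import Data.Nat.Properties using (≤-refl; ≤-trans; ≤-reflexive; <⇒≤; <⇒≱; ≮⇒≥; ≰⇒≥; n≤1+n; m≤n⇒m≤1+n; m≤m+n; m≤n+m; m≤m*n; m≤n*m; m^n≢0; +-mono-≤; +-monoˡ-≤; *-mono-≤; *-monoˡ-≤; *-monoʳ-≤; *-cancelʳ-≤; ^-monoˡ-≤; ^-monoʳ-≤; *-comm; *-assoc; *-identityˡ; *-identityʳ; *-distribˡ-+; ^-identityʳ; [m*n]*[o*p]≡[m*o]*[n*p]; module ≤-Reasoning)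
open import Data.Product using (∃; _×_; _,_; proj₁; proj₂; uncurry)
open import Data.Rational as ℚ using (ℚ; mkℚ; 0ℚ; 1ℚ; _<_)
import Data.Rational.Properties as ℚ
import Data.Rational.Unnormalised as ℚᵘ
import Data.Rational.Unnormalised.Properties as ℚᵘ
open import Data.Sum using (_⊎_; inj₁; inj₂; swap)
open import Data.Vec as Vec using (Vec; []; _∷_; tabulate)
import Data.Vec.Functional as F
open import Data.Vec.Properties using (lookup∘tabulate; tabulate∘lookup; tabulate-cong; lookup⇒[]=; []=⇒lookup; ∷-injective)
open import Function using (_∘_; id)
open import Function.Bundles using (_⇔_; mk⇔; Equivalence)
open import Function.Definitions using (Injective)
open import Level using (0ℓ)
open import Relation.Binary.Construct.Closure.ReflexiveTransitive using (Star; ε; _◅_)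
open import Relation.Binary.Definitions using (Symmetric; Irreflexive)
open import Relation.Binary.PropositionalEquality using (_≡_; refl; sym; trans; cong; cong₂; subst; subst₂; _≗_)
open import Relation.Nullary using (Dec; yes; no; ¬_; contradiction; _×-dec_; _⊎-dec_; ¬?; does; dec⇒maybe)
open import Relation.Nullary.Decidable using (dec-true; decidable-stable)
open import Relation.Unary using (Pred; Decidable)

open Graph using (edges; isSimple)
open Equivalence using (to; from)

private
  variable
    h k m n t : ℕ
    A : Set

-- Finite enumerations, and edge sets given by decidable relations.

lookup-injective : {xs : List A} → Unique xs → Injective _≡_ _≡_ (lookup xs)
lookup-injective (_ ∷ _) {zero} {zero} _ = refl
lookup-injective (x∉ ∷ _) {zero} {suc j} e = contradiction e (All.lookup x∉ (∈-lookup j))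
lookup-injective (x∉ ∷ _) {suc i} {zero} e = contradiction (sym e) (All.lookup x∉ (∈-lookup i))
lookup-injective (_ ∷ u) {suc i} {suc j} e = cong suc (lookup-injective u e)

injection⇒≤length : {xs : List A} {g : Fin t → A} → Injective _≡_ _≡_ g →
                    (∀ i → g i ∈ˡ xs) → t ≤ length xs
injection⇒≤length {xs = xs} inj g∈ = injective⇒≤ {f = index ∘ g∈} λ {i} {j} e →
  inj (trans (Any.lookup-index (g∈ i)) (trans (cong (lookup xs) e) (sym (Any.lookup-index (g∈ j)))))

unique⇒length≤ : {xs ys : List A} → Unique xs → (∀ {x} → x ∈ˡ xs → x ∈ˡ ys) → length xs ≤ length ys
unique⇒length≤ u ⊆ = injection⇒≤length (lookup-injective u) (⊆ ∘ ∈-lookup)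

vectors-unique : {xs : List A} → Unique xs → ∀ n → Unique (vectors xs n)
vectors-unique u zero    = [] ∷ []
vectors-unique u (suc n) = Unique.cartesianProductWith⁺ _∷_ ∷-injective u (vectors-unique u n)

∈-vectors : {xs : List A} (v : Vec A n) → (∀ i → Vec.lookup v i ∈ˡ xs) → v ∈ˡ vectors xs n
∈-vectors []      _  = here refl
∈-vectors (_ ∷ v) v∈ = ∈-cartesianProductWith⁺ _∷_ (v∈ zero) (∈-vectors v (v∈ ∘ suc))

tabulate-∈-vectors : {xs : List A} {φ : Fin n → A} → (∀ i → φ i ∈ˡ xs) → tabulate φ ∈ˡ vectors xs n
tabulate-∈-vectors {xs = xs} {φ} φ∈ =
  ∈-vectors (tabulate φ) λ i → subst (_∈ˡ xs) (sym (lookup∘tabulate φ i)) (φ∈ i)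

∈-subsets : (V : Subset n) → V ∈ˡ subsets n
∈-subsets V = ∈-vectors V λ i → side (Vec.lookup V i)
  where
  side : ∀ b → b ∈ˡ (outside ∷ inside ∷ [])
  side outside = here refl
  side inside  = there (here refl)

subsets-unique : ∀ n → Unique (subsets n)
subsets-unique n = vectors-unique (((λ ()) ∷ []) ∷ [] ∷ []) n

∈-parts : (S : Part n) → S ∈ˡ parts n
∈-parts (V , E) = ∈-cartesianProduct⁺ (∈-subsets V) (∈-vectors E (∈-subsets ∘ Vec.lookup E))

parts-unique : ∀ n → Unique (parts n)
parts-unique n = Unique.cartesianProduct⁺ (subsets-unique n) (vectors-unique (subsets-unique n) n)

-- The opaque definitions keep unification from unfolding decision procedures
-- and the enumeration behind ex.
opaque
  comprehension : {P : Pred (Fin n) 0ℓ} → Decidable P → Subset n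
  comprehension P? = tabulate (does ∘ P?)

  ∈-comprehension : {P : Pred (Fin n) 0ℓ} (P? : Decidable P) {x : Fin n} → x ∈ comprehension P? ⇔ P x
  ∈-comprehension {P = P} P? {x} = mk⇔ elim intro
    where
    elim : x ∈ comprehension P? → P x
    elim x∈ with P? x | trans (sym (lookup∘tabulate (does ∘ P?) x)) ([]=⇒lookup x∈)
    ... | yes p | _ = p
    intro : P x → x ∈ comprehension P?
    intro p = lookup⇒[]= x _ (trans (lookup∘tabulate (does ∘ P?) x) (dec-true (P? x) p))

  edgesFrom : {R : Fin n → Fin n → Set} → (∀ x y → Dec (R x y)) → Edges n
  edgesFrom R? = tabulate (comprehension ∘ R?)

  ∈-edgesFrom : {R : Fin n → Fin n → Set} (R? : ∀ x y → Dec (R x y)) {x y : Fin n} →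
                edgesFrom R? ∋ x ~ y ⇔ R x y
  ∈-edgesFrom R? {x} {y} rewrite lookup∘tabulate (comprehension ∘ R?) x = ∈-comprehension (R? x)

subset-ext : {V W : Subset n} → (∀ x → x ∈ V ⇔ x ∈ W) → V ≡ W
subset-ext V⇔W = ⊆-antisym (to (V⇔W _)) (from (V⇔W _))

edges-ext : {E F : Edges n} → (∀ x y → (E ∋ x ~ y) ⇔ (F ∋ x ~ y)) → E ≡ F
edges-ext {E = E} {F} E⇔F = trans (sym (tabulate∘lookup E))
  (trans (tabulate-cong λ x → subset-ext (E⇔F x)) (tabulate∘lookup F))

graphFrom : {R : Fin n → Fin n → Set} → (∀ x y → Dec (R x y)) →
            Symmetric R → Irreflexive _≡_ R → Graph n
graphFrom R? s i = graph (edgesFrom R?) record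
  { symmetric   = from (∈-edgesFrom R?) ∘ s ∘ to (∈-edgesFrom R?)
  ; irreflexive = λ e → i e ∘ to (∈-edgesFrom R?)
  }

adjacent? : (G : Graph n) (x y : Fin n) → Dec (edges G ∋ x ~ y)
adjacent? G x y = y ∈? Vec.lookup (edges G) x

~-sym : (G : Graph n) → ∀ {x y} → edges G ∋ x ~ y → edges G ∋ y ~ x
~-sym G = IsSimple.symmetric (isSimple G)

~⇒≢ : (G : Graph n) → ∀ {x y} → edges G ∋ x ~ y → ¬ x ≡ y
~⇒≢ G x~y e = IsSimple.irreflexive (isSimple G) e x~y

-- Embeddings, and copies as their images.

record Embedding (H : Graph h) (G : Graph n) (φ : Fin h → Fin n) : Set where
  field
    injective : Injective _≡_ _≡_ φ
    homo      : ∀ {i j} → edges H ∋ i ~ j → edges G ∋ φ i ~ φ j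

open Embedding

embedding-∘ : {H : Graph h} {G : Graph m} {K : Graph n} {φ : Fin h → Fin m} {f : Fin m → Fin n} →
              Embedding G K f → Embedding H G φ → Embedding H K (f ∘ φ)
embedding-∘ f φ = record { injective = injective φ ∘ injective f ; homo = homo f ∘ homo φ }

-- Graphs with the same edges may carry different `isSimple` proofs, so the identity embedding
-- stands in for an equality of graphs.
edges≡⇒embedding : {G K : Graph n} → edges G ≡ edges K → Embedding G K id
edges≡⇒embedding e = record { injective = id ; homo = subst (_∋ _ ~ _) e }

module _ (H : Graph h) (φ : Fin h → Fin n) where

  private
    V? : (x : Fin n) → Dec (∃ λ i → φ i ≡ x)
    V? x = any? λ i → φ i ≟ᶠ x

    E? : (x y : Fin n) → Dec (∃ λ i → ∃ λ j → φ i ≡ x × φ j ≡ y × edges H ∋ i ~ j)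
    E? x y = any? λ i → any? λ j → (φ i ≟ᶠ x) ×-dec (φ j ≟ᶠ y) ×-dec adjacent? H i j

  opaque
    image : Part n
    image = comprehension V? , edgesFrom E?

    ∈-imageV : ∀ {x} → x ∈ proj₁ image ⇔ ∃ λ i → φ i ≡ x
    ∈-imageV = ∈-comprehension V?

    ∈-imageE : ∀ {x y} → proj₂ image ∋ x ~ y ⇔ ∃ λ i → ∃ λ j → φ i ≡ x × φ j ≡ y × edges H ∋ i ~ j
    ∈-imageE = ∈-edgesFrom E?

part-ext : {S T : Part n} → (∀ x → x ∈ proj₁ S ⇔ x ∈ proj₁ T) →
           (∀ x y → (proj₂ S ∋ x ~ y) ⇔ (proj₂ T ∋ x ~ y)) → S ≡ T
part-ext p q = cong₂ _,_ (subset-ext p) (edges-ext q)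

module _ (H : Graph h) (φ : Fin h → Fin n) {S : Part n} where

  ≡image : (∀ x → x ∈ proj₁ S ⇔ ∃ λ i → φ i ≡ x) →
           (∀ x y → proj₂ S ∋ x ~ y ⇔ ∃ λ i → ∃ λ j → φ i ≡ x × φ j ≡ y × edges H ∋ i ~ j) →
           S ≡ image H φ
  ≡image p q = part-ext
    (λ x → mk⇔ (from (∈-imageV H φ) ∘ to (p x)) (from (p x) ∘ to (∈-imageV H φ)))
    (λ x y → mk⇔ (from (∈-imageE H φ) ∘ to (q x y)) (from (q x y) ∘ to (∈-imageE H φ)))

image-cong : {H : Graph h} {φ ψ : Fin h → Fin n} → φ ≗ ψ → image H φ ≡ image H ψ
image-cong {H = H} {φ} {ψ} e = ≡image H ψ
  (λ x → mk⇔ (λ x∈ → let i , p = to (∈-imageV H φ) x∈ in i , trans (sym (e i)) p)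
             (λ (i , p) → from (∈-imageV H φ) (i , trans (e i) p)))
  (λ x y → mk⇔ (λ xy∈ → let i , j , p , q , r = to (∈-imageE H φ) xy∈
                        in i , j , trans (sym (e i)) p , trans (sym (e j)) q , r)
               (λ (i , j , p , q , r) → from (∈-imageE H φ) (i , j , trans (e i) p , trans (e j) q , r)))

-- `φ` and `ψ` may differ by an automorphism of `H`, so they need not agree pointwise. But
-- `image H (f ∘ φ)` is obtained by applying `f` to the part `image H φ`, which `ψ` shares.
image-∘ : {H : Graph h} {φ ψ : Fin h → Fin m} (f : Fin m → Fin n) →
          image H φ ≡ image H ψ → image H (f ∘ φ) ≡ image H (f ∘ ψ)
image-∘ {H = H} {φ} {ψ} f e = part-ext
  (λ x → mk⇔ (V φ ψ e) (V ψ φ (sym e)))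
  (λ x y → mk⇔ (E φ ψ e) (E ψ φ (sym e)))
  where
  V : ∀ φ ψ → image H φ ≡ image H ψ → ∀ {x} →
      x ∈ proj₁ (image H (f ∘ φ)) → x ∈ proj₁ (image H (f ∘ ψ))
  V φ ψ e x∈ =
    let i , p = to (∈-imageV H (f ∘ φ)) x∈
        j , q = to (∈-imageV H ψ) (subst (λ S → φ i ∈ proj₁ S) e (from (∈-imageV H φ) (i , refl)))
    in from (∈-imageV H (f ∘ ψ)) (j , trans (cong f q) p)
  E : ∀ φ ψ → image H φ ≡ image H ψ → ∀ {x y} →
      proj₂ (image H (f ∘ φ)) ∋ x ~ y → proj₂ (image H (f ∘ ψ)) ∋ x ~ y
  E φ ψ e xy∈ =
    let i , j , p , q , r = to (∈-imageE H (f ∘ φ)) xy∈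
        i′ , j′ , p′ , q′ , r′ = to (∈-imageE H ψ)
          (subst (λ S → proj₂ S ∋ φ i ~ φ j) e (from (∈-imageE H φ) (i , j , refl , refl , r)))
    in from (∈-imageE H (f ∘ ψ)) (i′ , j′ , trans (cong f p′) p , trans (cong f q′) q , r′)

module _ {H : Graph h} {G : Graph n} where

  image-isCopy : {φ : Fin h → Fin n} → Embedding H G φ → IsCopy H G (image H φ)
  image-isCopy {φ} η =
    record
      { symmetric = λ xy → let i , j , p , q , r = to (∈-imageE H φ) xy
                           in from (∈-imageE H φ) (j , i , q , p , ~-sym H r)
      ; endpoints = λ x y xy → let i , j , p , q , r = to (∈-imageE H φ) xy
                               in from (∈-imageV H φ) (i , p) , from (∈-imageV H φ) (j , q)
      ; contained = λ x y xy → contained (to (∈-imageE H φ) xy)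
      } ,
    φ , record
      { injective = injective η
      ; image     = λ x → ∈-imageV H φ
      ; adjacency = λ i j → mk⇔ (λ r → from (∈-imageE H φ) (i , j , refl , refl , r))
                                (λ xy → adjacency (to (∈-imageE H φ) xy))
      }
    where
    contained : ∀ {x y} → (∃ λ i → ∃ λ j → φ i ≡ x × φ j ≡ y × edges H ∋ i ~ j) → edges G ∋ x ~ y
    contained (i , j , refl , refl , r) = homo η r
    adjacency : ∀ {i j} → (∃ λ i′ → ∃ λ j′ → φ i′ ≡ φ i × φ j′ ≡ φ j × edges H ∋ i′ ~ j′) → edges H ∋ i ~ j
    adjacency (i′ , j′ , p , q , r) with refl ← injective η p | refl ← injective η q = r

  -- `endpoints` puts the ends of each edge of `S` in the range of `φ`, and the backward half of
  -- `adjacency` pulls the edge back to `H`; so `S` has nothing beyond the image.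
  isCopy-image : {S : Part n} → IsCopy H G S → ∃ λ φ → Embedding H G φ × S ≡ image H φ
  isCopy-image {S} (sub , φ , iso) =
    φ ,
    record { injective = iso.injective ; homo = λ r → sub.contained _ _ (to (iso.adjacency _ _) r) } ,
    ≡image H φ iso.image λ x y → mk⇔
      (λ xy → let x∈ , y∈ = sub.endpoints x y xy
                  i , p = to (iso.image x) x∈
                  j , q = to (iso.image y) y∈
              in i , j , p , q , from (iso.adjacency i j)
                   (subst₂ (proj₂ S ∋_~_) (sym p) (sym q) xy))
      (λ { (i , j , refl , refl , r) → to (iso.adjacency i j) r })
    where
    module sub = _⊑_ sub
    module iso = IsIso iso

  contains⇔embedding : Contains G H ⇔ ∃ (Embedding H G)
  contains⇔embedding = mk⇔ (λ (S , c) → let φ , η , _ = isCopy-image c in φ , η)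
                           (λ (φ , η) → image H φ , image-isCopy η)

  -- Injectivity is asked of the images, since embeddings that differ by an automorphism of `H` give
  -- the same copy.
  ≤copies : {φ : Fin t → Fin h → Fin n} → (∀ c → Embedding H G (φ c)) →
            Injective _≡_ _≡_ (image H ∘ φ) → t ≤ copies H G
  ≤copies {φ = φ} η inj = injection⇒≤length inj λ c →
    ∈-filter⁺ (isCopy? H G) (∈-parts (image H (φ c))) (image-isCopy (η c))

  opaque
    -- The list of copies has no repetitions, so its first `t` entries are distinct, and each is the
    -- image of an embedding.
    ≤copies⁻ : t ≤ copies H G → ∃ λ (φ : Fin t → Fin h → Fin n) →
               (∀ c → Embedding H G (φ c)) × Injective _≡_ _≡_ (image H ∘ φ)
    ≤copies⁻ {t} t≤ =
      (λ c → proj₁ (copy c)) , (λ c → proj₁ (proj₂ (copy c))) , λ {c} {d} e →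
        inject≤-injective t≤ t≤ c d (lookup-injective (Unique.filter⁺ (isCopy? H G) (parts-unique n))
          (trans (proj₂ (proj₂ (copy c))) (trans e (sym (proj₂ (proj₂ (copy d)))))))
      where
      S : Fin t → Part n
      S c = lookup (filter (isCopy? H G) (parts n)) (inject≤ c t≤)
      copy : ∀ c → ∃ λ φ → Embedding H G φ × S c ≡ image H φ
      copy c = isCopy-image (proj₂ (∈-filter⁻ (isCopy? H G) {xs = parts n} (∈-lookup (inject≤ c t≤))))

  -- Every copy is the image of an embedding tabulated in `vs`. Entries that are not embeddings, or
  -- that share an image, only weaken the bound.
  copies≤ : (vs : List (Vec (Fin n) h)) → (∀ {φ} → Embedding H G φ → tabulate φ ∈ˡ vs) →
            copies H G ≤ length vs
  copies≤ vs cover = ≤-trans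
    (unique⇒length≤ (Unique.filter⁺ (isCopy? H G) (parts-unique n)) λ S∈ →
      covered (proj₂ (∈-filter⁻ (isCopy? H G) {xs = parts n} S∈)))
    (≤-reflexive (length-map (image H ∘ Vec.lookup) vs))
    where
    covered : ∀ {S} → IsCopy H G S → S ∈ˡ map (image H ∘ Vec.lookup) vs
    covered c with φ , η , refl ← isCopy-image c =
      subst (_∈ˡ _) (image-cong {H = H} (lookup∘tabulate φ)) (∈-map⁺ (image H ∘ Vec.lookup) (cover η))

copies-resp : (H : Graph h) {G K : Graph n} → edges G ≡ edges K → copies H G ≤ copies H K
copies-resp H {G} e = let φ , η , inj = ≤copies⁻ {H = H} {G} ≤-refl
                      in ≤copies (λ c → embedding-∘ (edges≡⇒embedding e) (η c)) inj

free-antitone : {𝓕 : Family} {G : Graph m} {K : Graph n} {f : Fin m → Fin n} →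
                Embedding G K f → Free 𝓕 K → Free 𝓕 G
free-antitone f = All.map λ ∌F c → let φ , η = to contains⇔embedding c
                                   in ∌F (from contains⇔embedding (_ , embedding-∘ f η))

-- The extremal number `ex`.

-- The enumeration pairs each edge set with the proof that `simple?` finds, so only the edges of `G`
-- are recovered, not `G` itself.
graphs-complete : (G : Graph n) → ∃ λ K → K ∈ˡ graphs n × edges G ≡ edges K
graphs-complete {n} G = find (Any.mapMaybe⁺ candidate (vectors (subsets n) n)
  (Any.map⁺ (Any.map hit (∈-vectors (edges G) (∈-subsets ∘ Vec.lookup (edges G))))))
  where
  candidate : Edges n → Maybe.Maybe (Graph n)
  candidate E = Maybe.map (graph E) (dec⇒maybe (simple? E))
  hit : ∀ {E} → edges G ≡ E → MAny (λ K → edges G ≡ edges K) (candidate E)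
  hit refl with simple? (edges G)
  ... | yes _ = mjust refl
  ... | no ¬s = contradiction (isSimple G) ¬s

module _ {H : Graph h} {𝓕 : Family} where

  ≤ex : {G : Graph n} → Free 𝓕 G → copies H G ≤ ex n H 𝓕
  ≤ex {n} {G} G-free =
    let K , K∈ , e = graphs-complete G
        K-free = free-antitone {𝓕 = 𝓕} (edges≡⇒embedding {G = K} {G} (sym e)) G-free
    in ≤-trans (copies-resp H {G} {K} e)
         (v≤max⁺ 0 _ (inj₂ (Any.map ≤-reflexive (∈-map⁺ (copies H) (∈-filter⁺ (free? 𝓕) K∈ K-free)))))

  ex≤ : ∀ {b} → (∀ {G : Graph n} → Free 𝓕 G → copies H G ≤ b) → ex n H 𝓕 ≤ b
  ex≤ {n} bound = max≤v⁺ z≤n (All.map⁺ (All.map bound (All.all-filter (free? 𝓕) (graphs n))))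

  opaque
    -- `max` returns its default 0 or an entry of the list. Positivity of `t` rules out the default,
    -- so some free graph attains the maximum.
    ≤ex⁻ : ∀ {t} → 0 ℕ.< t → t ≤ ex n H 𝓕 → ∃ λ (G : Graph n) → Free 𝓕 G × t ≤ copies H G
    ≤ex⁻ {n} 0<t t≤ with argmax-sel id 0 (map (copies H) (filter (free? 𝓕) (graphs n)))
    ... | inj₁ ex≡0 = contradiction (≤-trans t≤ (≤-reflexive ex≡0)) (<⇒≱ 0<t)
    ... | inj₂ ex∈ with G , G∈ , e ← ∈-map⁻ (copies H) ex∈ =
      G , proj₂ (∈-filter⁻ (free? 𝓕) {xs = graphs n} G∈) , ≤-trans t≤ (≤-reflexive e)

-- Induced subgraphs on a prescribed number of vertices.

-- Pigeonhole: if `f` hit every point, choosing preimages would inject `Fin n` into `Fin m`.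
fresh : {f : Fin m → Fin n} → m ℕ.< n → ∃ λ x → ∀ i → ¬ f i ≡ x
fresh {f = f} m<n with any? (λ x → all? (λ i → ¬? (f i ≟ᶠ x)))
... | yes found = found
... | no ¬found = contradiction (injective⇒≤ preimage-injective) (<⇒≱ m<n)
  where
  preimage : ∀ x → ∃ λ i → f i ≡ x
  preimage x = decidable-stable (any? λ i → f i ≟ᶠ x) λ ¬hit → ¬found (x , λ i e → ¬hit (i , e))
  preimage-injective : Injective _≡_ _≡_ (proj₁ ∘ preimage)
  preimage-injective {x} {y} e = trans (sym (proj₂ (preimage x))) (trans (cong f e) (proj₂ (preimage y)))

∷-injective⁺ : {x : A} {f : Fin m → A} → Injective _≡_ _≡_ f → (∀ i → ¬ f i ≡ x) →
               Injective _≡_ _≡_ (x F.∷ f)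
∷-injective⁺ inj x∉ {zero}  {zero}  _ = refl
∷-injective⁺ inj x∉ {zero}  {suc j} e = contradiction (sym e) (x∉ j)
∷-injective⁺ inj x∉ {suc i} {zero}  e = contradiction e (x∉ i)
∷-injective⁺ inj x∉ {suc i} {suc j} e = cong suc (inj e)

opaque
  -- `g` may repeat values, while `f` must be injective on all of `Fin m`. The values of `g` are
  -- added in turn; where one is already present, a fresh point is added instead.
  cover : (g : Fin k → Fin n) → k ≤ m → m ≤ n →
          ∃ λ (f : Fin m → Fin n) → Injective _≡_ _≡_ f × (∀ i → ∃ λ j → f j ≡ g i)
  cover {zero} g _ m≤n = (λ i → inject≤ i m≤n) , (λ {i} {j} → inject≤-injective m≤n m≤n i j) , λ ()
  cover {suc k} {n} {suc m} g (s≤s k≤m) m<n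
    with f , inj , hit ← cover (g ∘ suc) k≤m (≤-trans (n≤1+n m) m<n) = extend new
    where
    new : ∃ λ x → (∀ i → ¬ f i ≡ x) × ∃ λ j → (x F.∷ f) j ≡ g zero
    new with any? (λ j → f j ≟ᶠ g zero)
    ... | yes (j , e) = let x , x∉ = fresh m<n in x , x∉ , suc j , e
    ... | no ¬hit     = g zero , (λ i e → ¬hit (i , e)) , zero , refl
    extend : (∃ λ x → (∀ i → ¬ f i ≡ x) × ∃ λ j → (x F.∷ f) j ≡ g zero) →
             ∃ λ (f : Fin (suc m) → Fin n) → Injective _≡_ _≡_ f × (∀ i → ∃ λ j → f j ≡ g i)
    extend (x , x∉ , hit₀) = x F.∷ f , ∷-injective⁺ inj x∉ ,
      λ { zero → hit₀ ; (suc i) → let j , e = hit i in suc j , e }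

opaque
  induced : (Fin m → Fin n) → Graph n → Graph m
  induced f G = graphFrom (λ i j → adjacent? G (f i) (f j)) (~-sym G) λ { refl x~x → ~⇒≢ G x~x refl }

  ~-induced : {f : Fin m → Fin n} (G : Graph n) →
              ∀ {i j} → edges (induced f G) ∋ i ~ j ⇔ edges G ∋ f i ~ f j
  ~-induced {f = f} G = ∈-edgesFrom (λ i j → adjacent? G (f i) (f j))

induced-embedding : {f : Fin m → Fin n} (G : Graph n) → Injective _≡_ _≡_ f → Embedding (induced f G) G f
induced-embedding G inj = record { injective = inj ; homo = to (~-induced G) }

module _ {H : Graph h} {G : Graph n} {f : Fin m → Fin n} (f-inj : Injective _≡_ _≡_ f)
         {φ : Fin t → Fin h → Fin n} (hit : ∀ c i → ∃ λ j → f j ≡ φ c i) where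

  -- Each `φ c` factors through `f`. Distinct copies stay distinct in the induced graph because
  -- applying `f` recovers their images in `G`.
  ≤copies-induced : (∀ c → Embedding H G (φ c)) → Injective _≡_ _≡_ (image H ∘ φ) →
                    t ≤ copies H (induced f G)
  ≤copies-induced η inj = ≤copies ψ-embedding λ {c} {d} e →
    inj (trans (sym (f∘ψ c)) (trans (image-∘ f e) (f∘ψ d)))
    where
    ψ : Fin t → Fin h → Fin m
    ψ c i = proj₁ (hit c i)
    f∘ψ : ∀ c → image H (f ∘ ψ c) ≡ image H (φ c)
    f∘ψ c = image-cong (proj₂ ∘ hit c)
    ψ-embedding : ∀ c → Embedding H (induced f G) (ψ c)
    ψ-embedding c = record
      { injective = λ {i} {j} e → injective (η c)
          (trans (sym (proj₂ (hit c i))) (trans (cong f e) (proj₂ (hit c j))))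
      ; homo = λ {i} {j} i~j → from (~-induced G)
          (subst₂ (edges G ∋_~_) (sym (proj₂ (hit c i))) (sym (proj₂ (hit c j))) (homo (η c) i~j))
      }

cover₂ : (φ : Fin t → Fin h → Fin n) → t * h ≤ m → m ≤ n →
         ∃ λ (f : Fin m → Fin n) → Injective _≡_ _≡_ f × (∀ c i → ∃ λ j → f j ≡ φ c i)
cover₂ {t} {h} φ th≤m m≤n =
  let f , inj , hit = cover (uncurry φ ∘ remQuot {t} h) th≤m m≤n
  in f , inj , λ c i → let j , e = hit (combine c i)
                       in j , trans e (cong (uncurry φ) (remQuot-combine c i))

-- The `t` copies meet at most `t * h` vertices, which `cover₂` extends to exactly `suc h * t`. The
-- factor `suc h` makes the number of vertices grow with `t` even when `h` is 0.
≤ex-scaled : (H : Graph h) (𝓕 : Family) → 0 ℕ.< t → suc h * t ≤ n → t ≤ ex n H 𝓕 → t ≤ ex (suc h * t) H 𝓕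
≤ex-scaled {h} {t} H 𝓕 0<t m≤n t≤ =
  let G , G-free , t≤copies = ≤ex⁻ {H = H} {𝓕} 0<t t≤
      φ , η , inj = ≤copies⁻ {H = H} {G} t≤copies
      f , f-inj , hit = cover₂ φ (≤-trans (≤-reflexive (*-comm t h)) (*-monoˡ-≤ t (n≤1+n h))) m≤n
  in ≤-trans (≤copies-induced f-inj hit η inj)
       (≤ex {H = H} {𝓕} {G = induced f G} (free-antitone {𝓕 = 𝓕} (induced-embedding G f-inj) G-free))

-- No exponent strictly between 0 and 1.

-- As `p` is positive, `n ≤ n ^ p ≤ (A * e n) ^ q` for `n` from `N` on, so a bound on `e n` would
-- bound `n`.
unbounded : (e : ℕ → ℕ) {A N p q : ℕ} → 0 ℕ.< p → (∀ n → N ≤ n → n ^ p ≤ (A * e n) ^ q) →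
            ∀ M t → ∃ λ n → M ≤ n × t ≤ e n
unbounded e {A} {N} {suc p} {q} _ lower M t = v , M≤v , ≮⇒≥ λ ev<t → <⇒≱ (s≤s (m≤m+n _ _)) (begin
  v             ≤⟨ m≤m*n v (v ^ p) {{m^n≢0 v p}} ⟩
  v ^ suc p     ≤⟨ lower v N≤v ⟩
  (A * e v) ^ q ≤⟨ ^-monoˡ-≤ q (*-monoʳ-≤ A (<⇒≤ ev<t)) ⟩
  (A * t) ^ q   ∎)
  where
  open ≤-Reasoning
  -- Exceeds `(A * t) ^ q`, which rules out `e v < t`, and is at least both `M` and `N`.
  v = suc ((A * t) ^ q + (M + N))
  M≤v : M ≤ v
  M≤v = m≤n⇒m≤1+n (≤-trans (m≤m+n M N) (m≤n+m (M + N) ((A * t) ^ q)))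
  N≤v : N ≤ v
  N≤v = m≤n⇒m≤1+n (≤-trans (m≤n+m N M) (m≤n+m (M + N) ((A * t) ^ q)))

^-distribʳ-* : ∀ p m n → (m * n) ^ p ≡ m ^ p * n ^ p
^-distribʳ-* zero    m n = refl
^-distribʳ-* (suc p) m n = trans (cong (m * n *_) (^-distribʳ-* p m n)) ([m*n]*[o*p]≡[m*o]*[n*p] m n (m ^ p) (n ^ p))

-- At `n = suc k * u` the two bounds give `u ^ q ≤ C * u ^ p` with `C` independent of `u`. As
-- `suc p ≤ q`, this yields `u ≤ C`, which fails for `u` above `C`.
sublinear-contradiction : (e : ℕ → ℕ) {B N p q : ℕ} (k : ℕ) → p ℕ.< q →
  (∀ n → N ≤ n → e n ^ q ≤ B ^ q * n ^ p) → ¬ (∀ t → 0 ℕ.< t → t ≤ e (suc k * t))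
sublinear-contradiction e {B} {N} {p} {q} k p<q upper lower = <⇒≱ C<u (*-cancelʳ-≤ u C (u ^ p) {{m^n≢0 u p}} (begin
  u * u ^ p                        ≤⟨ ^-monoʳ-≤ u p<q ⟩
  u ^ q                            ≤⟨ ^-monoˡ-≤ q (lower u (s≤s z≤n)) ⟩
  e (suc k * u) ^ q                ≤⟨ upper (suc k * u) (≤-trans (m≤n+m N _) (≤-trans (n≤1+n _) (m≤n*m u (suc k)))) ⟩
  B ^ q * (suc k * u) ^ p          ≡⟨ cong (B ^ q *_) (^-distribʳ-* p (suc k) u) ⟩
  B ^ q * (suc k ^ p * u ^ p)      ≡⟨ *-assoc (B ^ q) _ _ ⟨
  C * u ^ p                        ∎))
  where
  open ≤-Reasoning
  C = B ^ q * suc k ^ p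
  u = suc (C + N)
  C<u : C ℕ.< u
  C<u = s≤s (m≤m+n C N)

0<r⇒0<numerator : {r : ℚ} → 0ℚ < r → 0 ℕ.< ℤ.∣ ℚ.↥ r ∣
0<r⇒0<numerator {mkℚ (+ zero) _ _}  0<r with +<+ () ← ℚ.drop-*<* 0<r
0<r⇒0<numerator {mkℚ (+ suc _) _ _} _   = s≤s z≤n
0<r⇒0<numerator {mkℚ -[1+ _ ] _ _}  _   = s≤s z≤n

0<r<1⇒numerator<denominator : {r : ℚ} → 0ℚ < r → r < 1ℚ → ℤ.∣ ℚ.↥ r ∣ ℕ.< ℚ.↧ₙ r
0<r<1⇒numerator<denominator {mkℚ (+ k) d _} _ r<1
  = ℤ.drop‿+<+ (subst₂ ℤ._<_ (ℤ.*-identityʳ (+ k)) (ℤ.*-identityˡ (+ suc d)) (ℚ.drop-*<* r<1))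
0<r<1⇒numerator<denominator {mkℚ -[1+ _ ] _ _} 0<r with () ← ℚ.drop-*<* 0<r

-- `ℚ./` normalises its result, so the comparison is made on unnormalised fractions, where the
-- second argument 0 of `mkℚᵘ` encodes denominator 1.
/1-mono-≤ : ∀ m n → m ≤ n → (+ m ℚ./ 1) ℚ.≤ (+ n ℚ./ 1)
/1-mono-≤ m n m≤n = ℚ.toℚᵘ-cancel-≤ (ℚᵘ.≤-respˡ-≃ (ℚᵘ.≃-sym (ℚ.toℚᵘ-fromℚᵘ (ℚᵘ.mkℚᵘ (+ m) 0)))
  (ℚᵘ.≤-respʳ-≃ (ℚᵘ.≃-sym (ℚ.toℚᵘ-fromℚᵘ (ℚᵘ.mkℚᵘ (+ n) 0)))
    (ℚᵘ.*≤* (ℤ.*-monoʳ-≤-nonNeg (+ 1) (ℤ.+≤+ m≤n)))))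

fractional-unrealizable : (H : Graph h) (r : ℚ) → 0ℚ < r → r < 1ℚ → ¬ Realizable H r
fractional-unrealizable {h} H r 0<r r<1 (_ , 𝓕 , A , B , N , bounds) =
  sublinear-contradiction (λ n → ex n H 𝓕) {B} h (0<r<1⇒numerator<denominator 0<r r<1)
    (λ n N≤n → proj₁ (bounds n N≤n)) λ t 0<t →
      -- Taking `n` at least `suc h * t` leaves room to choose that many vertices in the graph
      -- found.
      let n , m≤n , t≤ = unbounded (λ n → ex n H 𝓕) {A} {q = ℚ.↧ₙ r} (0<r⇒0<numerator 0<r)
                           (λ n N≤n → proj₂ (bounds n N≤n)) (suc h * t) t
      in ≤ex-scaled H 𝓕 0<t m≤n t≤

-- Lengths of enumerations.

length-concatMap≤ : {B : Set} (f : A → List B) {b : ℕ} → (∀ x → length (f x) ≤ b) →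
                    ∀ xs → length (concatMap f xs) ≤ length xs * b
length-concatMap≤ f bound []       = z≤n
length-concatMap≤ f bound (x ∷ xs) = ≤-trans (≤-reflexive (length-++ (f x)))
  (+-mono-≤ (bound x) (length-concatMap≤ f bound xs))

length-cartesianProductWith : {B C : Set} (f : A → B → C) → ∀ xs ys →
                              length (cartesianProductWith f xs ys) ≡ length xs * length ys
length-cartesianProductWith f []       ys = refl
length-cartesianProductWith f (x ∷ xs) ys = trans (length-++ (map (f x) ys))
  (cong₂ _+_ (length-map (f x) ys) (length-cartesianProductWith f xs ys))

length-vectors : (xs : List A) → ∀ n → length (vectors xs n) ≡ length xs ^ n
length-vectors xs zero    = refl
length-vectors xs (suc n) = trans (length-cartesianProductWith _∷_ xs (vectors xs n))
  (cong (length xs *_) (length-vectors xs n))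

-- Disjoint copies of `H`, and stars.

module _ (H : Graph h) (k : ℕ) (kh≤n : k * h ≤ n) where

  -- Vertex `i` of block `c`. The blocks fill the first `k * h` vertices; the others are isolated in
  -- `packing`.
  place : Fin k → Fin h → Fin n
  place c i = inject≤ (combine c i) kh≤n

  place-injective : ∀ {c d i j} → place c i ≡ place d j → c ≡ d × i ≡ j
  place-injective {c} {d} {i} {j} e =
    combine-injective c i d j (inject≤-injective kh≤n kh≤n (combine c i) (combine d j) e)

  opaque
    packing : Graph n
    packing = graphFrom
      (λ x y → any? λ c → any? λ i → any? λ j →
        (place c i ≟ᶠ x) ×-dec (place c j ≟ᶠ y) ×-dec adjacent? H i j)
      (λ (c , i , j , p , q , r) → c , j , i , q , p , ~-sym H r)
      λ { refl (c , i , j , p , q , r) → ~⇒≢ H r (proj₂ (place-injective (trans p (sym q)))) }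

    ~-packing : ∀ {x y} → edges packing ∋ x ~ y ⇔
                ∃ λ c → ∃ λ i → ∃ λ j → place c i ≡ x × place c j ≡ y × edges H ∋ i ~ j
    ~-packing = ∈-edgesFrom _

  place-embedding : ∀ c → Embedding H packing (place c)
  place-embedding c = record
    { injective = λ e → proj₂ (place-injective e)
    ; homo      = λ r → from ~-packing (c , _ , _ , refl , refl , r)
    }

  -- A vertex of the image reveals its block. For `h = 0` there is none, and all images are the
  -- empty part.
  place-image-injective : Fin h → Injective _≡_ _≡_ (image H ∘ place)
  place-image-injective i {c} {d} e =
    let j , p = to (∈-imageV H (place d)) (subst (λ S → place c i ∈ proj₁ S) e
                  (from (∈-imageV H (place c)) (i , refl)))
    in sym (proj₁ (place-injective p))

opaque
  star : ∀ h → Graph (suc h)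
  star h = graphFrom {R = λ x y → (x ≡ zero × ¬ y ≡ zero) ⊎ (y ≡ zero × ¬ x ≡ zero)}
    (λ x y → ((x ≟ᶠ zero) ×-dec ¬? (y ≟ᶠ zero)) ⊎-dec ((y ≟ᶠ zero) ×-dec ¬? (x ≟ᶠ zero)))
    swap (λ { refl (inj₁ (p , ¬p)) → ¬p p ; refl (inj₂ (p , ¬p)) → ¬p p })

  centre~leaf : ∀ {i} → edges (star h) ∋ zero ~ suc i
  centre~leaf = from (∈-edgesFrom _) (inj₁ (refl , λ ()))

  star-embedding : {G : Graph n} {x : Fin n} {leaf : Fin h → Fin n} → Injective _≡_ _≡_ leaf →
                   (∀ i → edges G ∋ x ~ leaf i) → Embedding (star h) G (x F.∷ leaf)
  star-embedding {G = G} {x} {leaf} inj x~ = record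
    { injective = ∷-injective⁺ inj λ i e → ~⇒≢ G (x~ i) (sym e)
    ; homo      = λ {i} {j} r → homo′ i j (to (∈-edgesFrom _) r)
    }
    where
    homo′ : ∀ i j → (i ≡ zero × ¬ j ≡ zero) ⊎ (j ≡ zero × ¬ i ≡ zero) →
            edges G ∋ (x F.∷ leaf) i ~ (x F.∷ leaf) j
    homo′ zero    zero    (inj₁ (_ , ¬p)) = contradiction refl ¬p
    homo′ zero    zero    (inj₂ (_ , ¬p)) = contradiction refl ¬p
    homo′ zero    (suc j) _               = x~ j
    homo′ (suc i) zero    _               = ~-sym G (x~ i)
    homo′ (suc i) (suc j) (inj₁ (() , _))
    homo′ (suc i) (suc j) (inj₂ (() , _))

-- Edges stay within a block, so all `h + 1` vertices of the star would lie in the block of its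
-- centre, which has only `h`.
packing-starfree : (H : Graph h) (k : ℕ) (kh≤n : k * h ≤ n) → Fin h → ¬ ∃ (Embedding (star h) (packing H k kh≤n))
packing-starfree {suc h} H k kh≤n _ (ψ , ψ-emb) = <⇒≱ ≤-refl (injective⇒≤ {f = proj₁ ∘ located} λ {x} {y} e →
  injective ψ-emb (trans (sym (proj₂ (located x)))
    (trans (cong (place H k kh≤n c) e) (proj₂ (located y)))))
  where
  spoke : ∀ i → ∃ λ c → ∃ λ j → ∃ λ j′ →
          place H k kh≤n c j ≡ ψ zero × place H k kh≤n c j′ ≡ ψ (suc i) × edges H ∋ j ~ j′
  spoke i = to (~-packing H k kh≤n) (homo ψ-emb centre~leaf)
  -- The block of the centre is read off the first spoke, which exists because `H` has a vertex.
  c = proj₁ (spoke zero)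
  located : ∀ x → ∃ λ j → place H k kh≤n c j ≡ ψ x
  located zero    = let _ , j , _ , p , _ = spoke zero in j , p
  located (suc i) =
    let _ , _ , _ , p₀ , _ = spoke zero
        _ , _ , j , p , q , _ = spoke i
    in j , trans (cong (λ d → place H k kh≤n d j) (proj₁ (place-injective H k kh≤n (trans p₀ (sym p))))) q

-- Balls in graphs of bounded degree, and exponent 1.

module _ (G : Graph n) where

  neighbours : Fin n → List (Fin n)
  neighbours x = filter (adjacent? G x) (allFin n)

  -- Vertices may be listed several times, as only an upper bound on the length matters.
  ball : ℕ → Fin n → List (Fin n)
  ball zero    x = x ∷ []
  ball (suc d) x = x ∷ concatMap (ball d) (neighbours x)

  degree≤ : ¬ ∃ (Embedding (star h) G) → ∀ x → length (neighbours x) ≤ h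
  degree≤ no-star x = ≰⇒≥ λ h≤ → no-star (_ , star-embedding
    {leaf = λ i → lookup (neighbours x) (inject≤ i h≤)}
    (λ {i} {j} e → inject≤-injective h≤ h≤ i j
      (lookup-injective (Unique.filter⁺ (adjacent? G x) (Unique.allFin⁺ n)) e))
    λ i → proj₂ (∈-filter⁻ (adjacent? G x) {xs = allFin n} (∈-lookup (inject≤ i h≤))))

-- The geometric sum 1 + b + ... + b^d.
ballSize : ℕ → ℕ → ℕ
ballSize b zero    = 1
ballSize b (suc d) = suc (b * ballSize b d)

length-ball≤ : {G : Graph n} {b : ℕ} → (∀ x → length (neighbours G x) ≤ b) →
               ∀ d x → length (ball G d x) ≤ ballSize b d
length-ball≤ deg zero    x = ≤-refl
length-ball≤ {G = G} {b} deg (suc d) x = s≤s (≤-trans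
  (length-concatMap≤ (ball G d) (length-ball≤ {G = G} deg d) (neighbours G x))
  (*-monoˡ-≤ (ballSize b d) (deg x)))

walkLength : {H : Graph h} → ∀ {i j} → Star (edges H ∋_~_) i j → ℕ
walkLength ε            = 0
walkLength {H = H} (_ ◅ w) = suc (walkLength {H = H} w)

-- An embedding carries a walk to a walk of the same length, and `ball` recurses along its steps.
-- The walk may be shorter than `d`, since each ball contains its centre.
walk-in-ball : {H : Graph h} {G : Graph n} {φ : Fin h → Fin n} → Embedding H G φ →
               ∀ {i j} (w : Star (edges H ∋_~_) i j) {d} → walkLength {H = H} w ≤ d → φ j ∈ˡ ball G d (φ i)
walk-in-ball η ε {zero}  _ = here refl
walk-in-ball η ε {suc d} _ = here refl
walk-in-ball {G = G} η (i~k ◅ w) {suc d} (s≤s w≤d) = there (∈-concatMap⁺ (ball G d)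
  (lose (∈-filter⁺ (adjacent? G _) (∈-allFin _) (homo η i~k)) (walk-in-ball η w w≤d)))

-- The image of `root` is one of `n` vertices, and every vertex of `H` is sent into the ball around
-- it. The bound on the size of this ball involves neither `n` nor `G`.
connected-copies≤ : {H : Graph h} → Connected H → ∀ b →
  ∃ λ B → ∀ {n} {G : Graph n} → (∀ x → length (neighbours G x) ≤ b) → copies H G ≤ n * B
connected-copies≤ {h} {H} (root , walk) b = ballSize b radius ^ h , λ {n} {G} deg → begin
  copies H G ≤⟨ copies≤ (candidates G) (λ η → ∈-concatMap⁺ (λ x → vectors (ball G radius x) h)
                  (lose (∈-allFin _) (tabulate-∈-vectors λ i → walk-in-ball η (walk root i) (walk≤radius i)))) ⟩
  length (candidates G) ≤⟨ length-concatMap≤ (λ x → vectors (ball G radius x) h) (λ x → begin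
      length (vectors (ball G radius x) h) ≡⟨ length-vectors (ball G radius x) h ⟩
      length (ball G radius x) ^ h         ≤⟨ ^-monoˡ-≤ h (length-ball≤ {G = G} deg radius x) ⟩
      ballSize b radius ^ h                ∎) (allFin n) ⟩
  length (allFin n) * ballSize b radius ^ h ≡⟨ cong (_* ballSize b radius ^ h) (length-tabulate {n = n} id) ⟩
  n * ballSize b radius ^ h ∎
  where
  open ≤-Reasoning
  lengths : List ℕ
  lengths = map (λ i → walkLength {H = H} (walk root i)) (allFin h)
  radius : ℕ
  -- The length of the longest of the given walks from `root`, fixed before `G` is.
  radius = max 0 lengths
  walk≤radius : ∀ i → walkLength {H = H} (walk root i) ≤ radius
  walk≤radius i = All.lookup (xs≤max 0 lengths) (∈-map⁺ _ (∈-allFin i))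
  candidates : ∀ {n} → Graph n → List (Vec (Fin n) h)
  candidates {n} G = concatMap (λ x → vectors (ball G radius x) h) (allFin n)

connected-realizes-1 : (H : Graph h) → Connected H → Realizable H 1ℚ
connected-realizes-1 {suc h} H conn =
  (ℚ.nonNegative⁻¹ 1ℚ , /1-mono-≤ 1 (suc h) (s≤s z≤n)) , 𝓕 , K , B , suc h , λ n h≤n →
  (begin
    ex n H 𝓕 ^ 1    ≡⟨ ^-identityʳ _ ⟩
    ex n H 𝓕        ≤⟨ ex≤ {H = H} {𝓕} {n} (λ {G} G-free → proj₂ upper {G = G} (degree≤ G (no-star G G-free))) ⟩
    n * B           ≡⟨ *-comm n B ⟩
    B * n           ≡⟨ cong₂ _*_ (^-identityʳ B) (^-identityʳ n) ⟨
    B ^ 1 * n ^ 1   ∎) ,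
  (begin
    n ^ 1                       ≡⟨ ^-identityʳ n ⟩
    n                           ≡⟨ m≡m%n+[m/n]*n n (suc h) ⟩
    -- As `n` is at least `suc h`, the quotient is positive, so the remainder is at most the
    -- multiple of `suc h` next to it. This doubling is the 2 in `K`.
    n % suc h + n / suc h * suc h ≤⟨ +-monoˡ-≤ _ (≤-trans (<⇒≤ (m%n<n n (suc h)))
                                       (m≤n*m (suc h) (n / suc h) {{>-nonZero (m≥n⇒m/n>0 h≤n)}})) ⟩
    n / suc h * suc h + n / suc h * suc h ≡⟨ *-distribˡ-+ (n / suc h) (suc h) (suc h) ⟨
    n / suc h * K               ≡⟨ *-comm (n / suc h) K ⟩
    K * (n / suc h)             ≤⟨ *-monoʳ-≤ K (lower n) ⟩
    K * ex n H 𝓕                ≡⟨ ^-identityʳ _ ⟨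
    (K * ex n H 𝓕) ^ 1          ∎)
  where
  open ≤-Reasoning
  𝓕 : Family
  𝓕 = (_ , star (suc h)) ∷ []
  upper = connected-copies≤ {H = H} conn (suc h)
  K B : ℕ
  K = suc h + suc h
  B = proj₁ upper
  no-star : ∀ {n} (G : Graph n) → Free 𝓕 G → ¬ ∃ (Embedding (star (suc h)) G)
  no-star G (∌star ∷ []) = ∌star ∘ from contains⇔embedding
  lower : ∀ n → n / suc h ≤ ex n H 𝓕
  lower n = ≤-trans
    (≤copies (place-embedding H (n / suc h) kh≤n) (place-image-injective H (n / suc h) kh≤n zero))
    (≤ex {H = H} {𝓕} ((packing-starfree H (n / suc h) kh≤n zero ∘ to contains⇔embedding) ∷ []))
    where kh≤n = m/n*n≤m n (suc h)
connected-realizes-1 {zero} H (() , _)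

-- Non-isolated vertices, and exponent 0.

nonIsolated? : (G : Graph n) → Decidable (λ x → ∃ λ y → edges G ∋ x ~ y)
nonIsolated? G x = any? (adjacent? G x)

nonIsolated : Graph n → List (Fin n)
nonIsolated {n} G = filter (nonIsolated? G) (allFin n)

∈-nonIsolated⁺ : (G : Graph n) → ∀ {x y} → edges G ∋ x ~ y → x ∈ˡ nonIsolated G
∈-nonIsolated⁺ G x~y = ∈-filter⁺ (nonIsolated? G) (∈-allFin _) (_ , x~y)

∈-nonIsolated⁻ : (G : Graph n) → ∀ {x} → x ∈ˡ nonIsolated G → ∃ λ y → edges G ∋ x ~ y
∈-nonIsolated⁻ {n} G x∈ = proj₂ (∈-filter⁻ (nonIsolated? G) {xs = allFin n} x∈)

nonIsolated-lookup-injective : (G : Graph n) → Injective _≡_ _≡_ (lookup (nonIsolated G))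
nonIsolated-lookup-injective {n} G = lookup-injective (Unique.filter⁺ (nonIsolated? G) (Unique.allFin⁺ n))

-- A graph with more than h non-isolated vertices has a subgraph on 2 (h + 1)
-- vertices with this property: choose h + 1 of them and a neighbour of each.
manyNonIsolated : ℕ → Family
manyNonIsolated h = map (_ ,_) (filter (λ G → h <? length (nonIsolated G)) (graphs (2 * suc h)))

nonIsolated≤ : {G : Graph n} → 2 * suc h ≤ n → Free (manyNonIsolated h) G → length (nonIsolated G) ≤ h
nonIsolated≤ {n} {h} {G} m≤n G-free = ≮⇒≥ λ h< →
  let x : Fin (suc h) → Fin n
      x i = lookup (nonIsolated G) (inject≤ i h<)
      neighbour : ∀ i → ∃ λ y → edges G ∋ x i ~ y
      neighbour i = ∈-nonIsolated⁻ G (∈-lookup (inject≤ i h<))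
      -- The two rows are the `suc h` chosen vertices and a neighbour of each. Neighbours may
      -- coincide with each other or with chosen vertices; `cover₂` then pads to `2 * suc h`.
      f , f-inj , hit = cover₂ {m = 2 * suc h} (x F.∷ (proj₁ ∘ neighbour) F.∷ F.[]) ≤-refl m≤n
      u = hit zero
      v = hit (suc zero)
      -- The family consists of enumerated graphs, so the induced graph is replaced by its
      -- representative.
      K , K∈ , e = graphs-complete (induced f G)
      u~v : ∀ i → edges K ∋ proj₁ (u i) ~ proj₁ (v i)
      u~v i = subst (_∋ proj₁ (u i) ~ proj₁ (v i)) e (from (~-induced G)
        (subst₂ (edges G ∋_~_) (sym (proj₂ (u i))) (sym (proj₂ (v i))) (proj₂ (neighbour i))))
      h<K : h ℕ.< length (nonIsolated K)
      h<K = injection⇒≤length {g = proj₁ ∘ u}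
        (λ {i} {j} e → inject≤-injective h< h< i j (nonIsolated-lookup-injective G
          (trans (sym (proj₂ (u i))) (trans (cong f e) (proj₂ (u j))))))
        (λ i → ∈-nonIsolated⁺ K (u~v i))
  in All.lookup G-free (∈-map⁺ _ (∈-filter⁺ (λ G → h <? length (nonIsolated G)) K∈ h<K))
       (from contains⇔embedding (f , embedding-∘ (induced-embedding G f-inj) (edges≡⇒embedding {G = K} (sym e))))

-- An embedding sends non-isolated vertices to ends of edges, and here all edges lie in one block of
-- `h` vertices, too few for a member of the family.
packing-free : (H : Graph h) (h≤n : 1 * h ≤ n) → Free (manyNonIsolated h) (packing H 1 h≤n)
packing-free {h} H h≤n = All.map⁺ (All.map (λ {F} h< contains →
  let ψ , ψ-emb = to contains⇔embedding contains
      inH : ∀ i → ∃ λ j → place H 1 h≤n zero j ≡ ψ (lookup (nonIsolated F) i)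
      inH i = let _ , r = ∈-nonIsolated⁻ F (∈-lookup i)
                  c , j , _ , p , _ = to (~-packing H 1 h≤n) (homo ψ-emb r)
              in j , trans (cong (λ c → place H 1 h≤n c j) (only c)) p
  in <⇒≱ h< (injective⇒≤ {f = proj₁ ∘ inH} λ {i} {j} e → nonIsolated-lookup-injective F (injective ψ-emb
       (trans (sym (proj₂ (inH i))) (trans (cong (place H 1 h≤n zero) e) (proj₂ (inH j)))))))
  (All.all-filter (λ G → h <? length (nonIsolated G)) (graphs (2 * suc h))))
  where
  only : (c : Fin 1) → zero ≡ c
  only zero = refl

-- Every vertex of `H` has a neighbour, so an embedding uses only non-isolated vertices. A large
-- free graph has at most `h` of them, which leaves `h ^ h` maps.
noIsolated-realizes-0 : (H : Graph h) → NoIsolatedVertex H → Realizable H 0ℚ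
noIsolated-realizes-0 {h} H noIso = (ℚ.≤-refl , /1-mono-≤ 0 h z≤n) , 𝓕 , 1 , h ^ h , 2 * suc h , λ n m≤n →
  (begin
    ex n H 𝓕 ^ 1      ≡⟨ ^-identityʳ _ ⟩
    ex n H 𝓕          ≤⟨ ex≤ {H = H} {𝓕} {n} (λ {G} G-free → upper G (nonIsolated≤ {G = G} m≤n G-free)) ⟩
    h ^ h             ≡⟨ ^-identityʳ _ ⟨
    (h ^ h) ^ 1       ≡⟨ *-identityʳ _ ⟨
    (h ^ h) ^ 1 * 1   ∎) ,
  (begin
    1                 ≤⟨ lower n (≤-trans (*-mono-≤ {1} {2} (s≤s z≤n) (n≤1+n h)) m≤n) ⟩
    ex n H 𝓕          ≡⟨ *-identityˡ _ ⟨
    1 * ex n H 𝓕      ≡⟨ ^-identityʳ _ ⟨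
    (1 * ex n H 𝓕) ^ 1 ∎)
  where
  open ≤-Reasoning
  𝓕 = manyNonIsolated h
  upper : ∀ {n} (G : Graph n) → length (nonIsolated G) ≤ h → copies H G ≤ h ^ h
  upper G few = begin
    copies H G                           ≤⟨ copies≤ (vectors (nonIsolated G) h) (λ η →
                                              tabulate-∈-vectors λ i → ∈-nonIsolated⁺ G (homo η (proj₂ (noIso i)))) ⟩
    length (vectors (nonIsolated G) h)   ≡⟨ length-vectors (nonIsolated G) h ⟩
    length (nonIsolated G) ^ h           ≤⟨ ^-monoˡ-≤ h few ⟩
    h ^ h                                ∎
  lower : ∀ n → 1 * h ≤ n → 1 ≤ ex n H 𝓕
  lower n h≤n = ≤-trans
    -- With one block the indices agree outright. This covers `h = 0`, where `place-image-injective`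
    -- does not apply.
    (≤copies (place-embedding H 1 h≤n) λ { {zero} {zero} _ → refl })
    (≤ex {H = H} {𝓕} {G = packing H 1 h≤n} (packing-free H h≤n))

proposition2p3 : (∀ {h} (H : Graph h) (r : ℚ) → 0ℚ < r → r < 1ℚ → ¬ Realizable H r) ×
    (∀ {h} (H : Graph h) → NoIsolatedVertex H → Realizable H 0ℚ) ×
    (∀ {h} (H : Graph h) → Connected H → Realizable H 1ℚ)
proposition2p3 = fractional-unrealizable , noIsolated-realizes-0 , connected-realizes-1
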